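{- For all integers $n\ge 2$ and $k\ge 1$, $b(n+1,k)\ge 2\,b(n,k)$.
   Context: A complete non-ambiguous matrix (CNM) of size $n$ is an $n\times n$ matrix $M=(m_{i,j})$ with entries in $\{0,1\}$ whose support $T=\{(i,j): m_{i,j}=1\}$ (whose elements are called vertices) satisfies: (1) $(1,1)\in T$; (2) for every $p=(i,j)\in T$ with $p\neq(1,1)$, exactly one of the following holds: there is $(i',j)\in T$ with $i'<i$, or there is $(i,j')\in T$ with $j'<j$; (3) every row and every column of $M$ contains at least one vertex; (4) define the parent of $p=(i,j)\neq(1,1)$ to be $(i',j)$ with $i'<i$ maximal if such a vertex exists, and otherwise $(i,j')$ with $j'<j$ maximal; then every vertex is the parent of either zero or exactly two vertices. A vertex with no children is a leaf. The leaf matrix $p(M)$ is obtained from $M$ by replacing all non-leaf vertices by $0$ (it is a permutation matrix). For $n\ge 1$ and $k\ge 0$, $b(n,k)$ denotes the number of permutations $\sigma\in S_n$ such that there are exactly $k$ CNMs $M$ of size $n$ whose leaf matrix $p(M)$ equals the permutation matrix of $\sigma$ (the matrix with $1$'s at positions $(i,\sigma(i))$). -}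

module Defs where

open import Data.Bool.Base using (Bool; true; false)
import Data.Bool.Properties as Bool
open import Data.Fin.Base using (Fin; toℕ; _<_; _≤_)
open import Data.Fin.Properties using (all?; any?; _<?_; _≤?_) renaming (_≟_ to _≟ᶠ_)
open import Data.List.Base using (List; []; _∷_; length; filter; allFin; cartesianProduct; cartesianProductWith)
open import Data.List.Membership.Propositional using (_∈_)
open import Data.List.Membership.Propositional.Properties using (∈-cartesianProductWith⁺)
open import Data.List.Relation.Unary.All using ([])
open import Data.List.Relation.Unary.AllPairs using ([]; _∷_)
open import Data.List.Relation.Unary.Any using (here)
open import Data.List.Relation.Unary.Unique.Propositional using (Unique)
open import Data.List.Relation.Unary.Unique.Propositional.Properties using (cartesianProductWith⁺)
open import Data.Nat.Base using (ℕ; zero; suc)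
import Data.Nat.Properties as ℕ
open import Data.Product.Base using (_×_; _,_; ∃; map₂)
open import Data.Sum.Base using (_⊎_)
open import Data.Vec.Base using (Vec; []; _∷_; lookup; tabulate)
open import Data.Vec.Properties using (≡-dec; ∷-injective)
open import Function.Definitions using (Bijective)
open import Level using (Level)
open import Relation.Binary.PropositionalEquality using (_≡_; refl)
open import Relation.Nullary.Decidable using (Dec; does; ¬?; _×-dec_; _⊎-dec_; _→-dec_; map′)
open import Relation.Nullary.Negation using (¬_)
open import Relation.Unary using (Pred; Decidable)

private
  variable
    a p : Level
    A : Set a
    m n : ℕ

count : {P : Pred A p} → Decidable P → List A → ℕ
count P? xs = length (filter P? xs)

allVec : List A → (n : ℕ) → List (Vec A n)
allVec xs zero    = [] ∷ []
allVec xs (suc n) = cartesianProductWith _∷_ xs (allVec xs n)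

-- If xs lists every element of A exactly once, then allVec xs n lists every
-- vector of length n exactly once, so counting over it is a cardinality.

allVec-complete : {xs : List A} → (∀ x → x ∈ xs) → (v : Vec A n) → v ∈ allVec xs n
allVec-complete x∈ []      = here refl
allVec-complete x∈ (x ∷ v) = ∈-cartesianProductWith⁺ _∷_ (x∈ x) (allVec-complete x∈ v)

allVec-unique : {xs : List A} → Unique xs → (n : ℕ) → Unique (allVec xs n)
allVec-unique u zero    = [] ∷ []
allVec-unique u (suc n) = cartesianProductWith⁺ _∷_ ∷-injective u (allVec-unique u n)

-- true is 1 and false is 0; positions are counted from 0 instead of 1.

Matrix : ℕ → Set
Matrix n = Vec (Vec Bool n) n

allMatrices : (n : ℕ) → List (Matrix n)
allMatrices n = allVec (allVec (true ∷ false ∷ []) n) n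

_≟ᴹ_ : (M N : Matrix n) → Dec (M ≡ N)
_≟ᴹ_ = ≡-dec (≡-dec Bool._≟_)

fromDec : {P : Fin n → Fin n → Set} → (∀ i j → Dec (P i j)) → Matrix n
fromDec P? = tabulate λ i → tabulate λ j → does (P? i j)

IsRoot : Fin n → Fin n → Set
IsRoot i j = toℕ i ≡ 0 × toℕ j ≡ 0

isRoot? : (i j : Fin n) → Dec (IsRoot i j)
isRoot? i j = (toℕ i ℕ.≟ 0) ×-dec (toℕ j ℕ.≟ 0)

module _ (M : Matrix n) where

  Vertex : Fin n → Fin n → Set
  Vertex i j = lookup (lookup M i) j ≡ true

  vertex? : ∀ i j → Dec (Vertex i j)
  vertex? i j = lookup (lookup M i) j Bool.≟ true

  HasAbove : Fin n → Fin n → Set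
  HasAbove i j = ∃ λ i′ → i′ < i × Vertex i′ j

  hasAbove? : ∀ i j → Dec (HasAbove i j)
  hasAbove? i j = any? λ i′ → (i′ <? i) ×-dec vertex? i′ j

  HasLeft : Fin n → Fin n → Set
  HasLeft i j = ∃ λ j′ → j′ < j × Vertex i j′

  hasLeft? : ∀ i j → Dec (HasLeft i j)
  hasLeft? i j = any? λ j′ → (j′ <? j) ×-dec vertex? i j′

  NearestAbove : Fin n → Fin n → Fin n → Set
  NearestAbove i′ i j =
    i′ < i × Vertex i′ j × (∀ i″ → i″ < i → Vertex i″ j → i″ ≤ i′)

  nearestAbove? : ∀ i′ i j → Dec (NearestAbove i′ i j)
  nearestAbove? i′ i j =
    (i′ <? i) ×-dec vertex? i′ j ×-dec
    all? λ i″ → (i″ <? i) →-dec (vertex? i″ j →-dec (i″ ≤? i′))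

  NearestLeft : Fin n → Fin n → Fin n → Set
  NearestLeft j′ i j =
    j′ < j × Vertex i j′ × (∀ j″ → j″ < j → Vertex i j″ → j″ ≤ j′)

  nearestLeft? : ∀ j′ i j → Dec (NearestLeft j′ i j)
  nearestLeft? j′ i j =
    (j′ <? j) ×-dec vertex? i j′ ×-dec
    all? λ j″ → (j″ <? j) →-dec (vertex? i j″ →-dec (j″ ≤? j′))

  -- (i′ , j′) is the parent of (i , j).

  Parent : Fin n → Fin n → Fin n → Fin n → Set
  Parent i′ j′ i j =
    Vertex i j × ¬ IsRoot i j ×
    ((j′ ≡ j × NearestAbove i′ i j) ⊎
     (¬ HasAbove i j × i′ ≡ i × NearestLeft j′ i j))

  parent? : ∀ i′ j′ i j → Dec (Parent i′ j′ i j)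
  parent? i′ j′ i j =
    vertex? i j ×-dec ¬? (isRoot? i j) ×-dec
    (((j′ ≟ᶠ j) ×-dec nearestAbove? i′ i j) ⊎-dec
     (¬? (hasAbove? i j) ×-dec (i′ ≟ᶠ i) ×-dec nearestLeft? j′ i j))

  #children : Fin n → Fin n → ℕ
  #children i j = count (λ (k , l) → parent? i j k l) (cartesianProduct (allFin n) (allFin n))

  Leaf : Fin n → Fin n → Set
  Leaf i j = Vertex i j × #children i j ≡ 0

  leaf? : ∀ i j → Dec (Leaf i j)
  leaf? i j = vertex? i j ×-dec (#children i j ℕ.≟ 0)

  leafMatrix : Matrix n
  leafMatrix = fromDec leaf?

  record IsCNM : Set where
    constructor isCNM
    field
      root     : ∃ λ i → ∃ λ j → IsRoot i j × Vertex i j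
      xor      : ∀ i j → Vertex i j → ¬ IsRoot i j →
                 (HasAbove i j × ¬ HasLeft i j) ⊎ (¬ HasAbove i j × HasLeft i j)
      rows     : ∀ i → ∃ λ j → Vertex i j
      columns  : ∀ j → ∃ λ i → Vertex i j
      complete : ∀ i j → Vertex i j → #children i j ≡ 0 ⊎ #children i j ≡ 2

  isCNM? : Dec IsCNM
  isCNM? = map′
    (λ (r , x , ro , co , c) → isCNM r x ro co c)
    (λ (isCNM r x ro co c) → r , x , ro , co , c)
    ( (any? λ i → any? λ j → isRoot? i j ×-dec vertex? i j)
    ×-dec (all? λ i → all? λ j → vertex? i j →-dec (¬? (isRoot? i j) →-dec
            ((hasAbove? i j ×-dec ¬? (hasLeft? i j)) ⊎-dec
             (¬? (hasAbove? i j) ×-dec hasLeft? i j))))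
    ×-dec (all? λ i → any? λ j → vertex? i j)
    ×-dec (all? λ j → any? λ i → vertex? i j)
    ×-dec (all? λ i → all? λ j → vertex? i j →-dec
            ((#children i j ℕ.≟ 0) ⊎-dec (#children i j ℕ.≟ 2))))

-- Permutations are in one-line notation: lookup σ i is σ(i).
-- Unlike Permutation′ n, vectors have a propositional equality under
-- which each permutation is counted once.

IsPermutation : Vec (Fin n) n → Set
IsPermutation σ = Bijective _≡_ _≡_ (lookup σ)

isPermutation? : (σ : Vec (Fin n) n) → Dec (IsPermutation σ)
isPermutation? σ = map′
  (λ (inj , sur) → (λ {x} {y} → inj x y) , λ y → map₂ (λ eq → λ { refl → eq }) (sur y))
  (λ (inj , sur) → (λ x y → inj {x} {y}) , λ y → map₂ (λ eq → eq refl) (sur y))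
  ((all? λ x → all? λ y → (lookup σ x ≟ᶠ lookup σ y) →-dec (x ≟ᶠ y))
  ×-dec (all? λ y → any? λ x → lookup σ x ≟ᶠ y))

permutationMatrix : Vec (Fin n) n → Matrix n
permutationMatrix σ = fromDec λ i j → lookup σ i ≟ᶠ j

#CNM : Vec (Fin n) n → ℕ
#CNM {n} σ =
  count (λ M → isCNM? M ×-dec (leafMatrix M ≟ᴹ permutationMatrix σ)) (allMatrices n)

b : ℕ → ℕ → ℕ
b n k = count (λ σ → isPermutation? σ ×-dec (#CNM σ ℕ.≟ k)) (allVec (allFin n) n)

{-# OPTIONS --safe #-}
module Submission where

-- Turning a leaf (i , σ i) into an inner vertex, whose two children are leaves in
-- a new last row and a new last column, sends a complete non-ambiguous matrix
-- with leaf permutation σ to one of size n + 1.  If i = n or σ i = n, every matrix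
-- with the new leaf permutation arises in this way, from exactly one matrix of
-- size n, so σ and the new permutation have the same number of matrices.  The
-- two choices i = n and i = σ⁻¹ n give two injections on permutations; their
-- images could only meet at a σ with σ n = n, but for n ≥ 2 such a σ has no
-- matrix, since the corner (n , n) cannot be a leaf.

open import Defs
open import Data.Bool.Base using (Bool; true; false; if_then_else_)
open import Data.Empty using (⊥-elim)
open import Data.Fin.Base using (Fin; zero; suc; toℕ; fromℕ; inject₁; _<_; _≤_)
open import Data.Fin.Properties as Fin using (any?; toℕ-inject₁; toℕ-fromℕ; toℕ<n; inject₁ℕ<; inject₁-injective; fromℕ≢inject₁) renaming (_≟_ to _≟ᶠ_)
open import Data.Fin.Relation.Unary.Top using (view; view-inject₁; view-fromℕ; ‵fromℕ; ‵inject₁)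
open import Data.List.Base using (List; []; _∷_; _++_; map; length; filter; allFin; cartesianProduct)
import Data.List.Base as List
open import Data.List.Membership.Propositional using (_∈_)
open import Data.List.Membership.Propositional.Properties using (∈-filter⁺; ∈-filter⁻; ∈-map⁻; ∈-++⁻; ∈-lookup; ∈-allFin; ∈-cartesianProduct⁺; ∈-length)
open import Data.List.Properties using (length-++; length-map)
open import Data.List.Relation.Unary.All using ([]; _∷_)
import Data.List.Relation.Unary.All as All
open import Data.List.Relation.Unary.AllPairs using ([]; _∷_)
open import Data.List.Relation.Unary.Any using (here; there)
open import Data.List.Relation.Unary.Any.Properties using (lookup-index)
open import Data.List.Relation.Unary.Unique.Propositional using (Unique)
import Data.List.Relation.Unary.Unique.Propositional.Properties as Unique
open import Data.Nat.Base using (ℕ; zero; suc; _+_; _*_; _≥_; z≤n; s≤s)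
import Data.Nat.Base as ℕ
import Data.Nat.Properties as ℕ
open import Data.Product.Base using (_×_; _,_; ∃; proj₁; proj₂)
open import Data.Sum.Base using (_⊎_; inj₁; inj₂)
import Data.Sum.Base as Sum
open import Data.Vec.Base using (Vec; lookup; tabulate)
open import Data.Vec.Properties using (lookup∘tabulate; tabulate∘lookup; tabulate-cong)
open import Function.Base using (_∘_; id)
open import Level using (Level)
open import Relation.Binary.Definitions using (tri<; tri≈; tri>)
open import Relation.Binary.PropositionalEquality using (_≡_; _≢_; refl; sym; trans; cong; subst; subst₂)
open import Relation.Nullary.Decidable using (Dec; does; yes; no; dec-true; dec-false; _×-dec_)
open import Relation.Nullary.Negation using (¬_; contradiction)
open import Relation.Unary using (Pred; Decidable)

private
  variable
    a p q : Level
    A B : Set a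
    n : ℕ

-- Counting

lookup-injective : {xs : List A} → Unique xs → ∀ i j → List.lookup xs i ≡ List.lookup xs j → i ≡ j
lookup-injective (_ ∷ _)  zero    zero    _  = refl
lookup-injective (x∉ ∷ _) zero    (suc j) eq = contradiction eq (All.lookup x∉ (∈-lookup j))
lookup-injective (x∉ ∷ _) (suc i) zero    eq = contradiction (sym eq) (All.lookup x∉ (∈-lookup i))
lookup-injective (_ ∷ u)  (suc i) (suc j) eq = cong suc (lookup-injective u i j eq)

-- Pigeonhole: each position in `xs` is sent to a position of the same element in `ys`, and this map
-- is injective because `xs` has no repetitions.
length-mono-⊆ : {xs ys : List A} → Unique xs → (∀ {x} → x ∈ xs → x ∈ ys) → length xs ℕ.≤ length ys
length-mono-⊆ {xs = xs} {ys} u xs⊆ys = Fin.injective⇒≤ λ {i} {j} eq →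
  lookup-injective u i j
    (trans (lookup-index (pos i)) (trans (cong (List.lookup ys) eq) (sym (lookup-index (pos j)))))
  where
  pos : ∀ i → List.lookup xs i ∈ ys
  pos i = xs⊆ys (∈-lookup i)

-- Injectivity is asked only on members of the list: `restrict` forgets a row and a column, so it is
-- injective only on matrices of a special shape.
map-unique : (f : A → B) {xs : List A} → Unique xs →
             (∀ {x y} → x ∈ xs → y ∈ xs → f x ≡ f y → x ≡ y) → Unique (map f xs)
map-unique f {[]}     []       inj = []
map-unique f {x ∷ xs} (x∉ ∷ u) inj =
  All.tabulate (λ z∈ eq → let (y , y∈ , z≡) = ∈-map⁻ f z∈ in
    All.lookup x∉ y∈ (inj (here refl) (there y∈) (trans eq z≡)))
  ∷ map-unique f u (λ y∈ z∈ → inj (there y∈) (there z∈))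

count-mono : {P : Pred A p} {Q : Pred B q} (P? : Decidable P) (Q? : Decidable Q)
             {xs : List A} {ys : List B} → Unique xs → (∀ y → y ∈ ys) → (f : A → B) →
             (∀ {x} → P x → Q (f x)) →
             (∀ {x y} → P x → P y → f x ≡ f y → x ≡ y) →
             count P? xs ℕ.≤ count Q? ys
count-mono {Q = Q} P? Q? {xs} {ys} u complete f P⇒Q inj =
  subst (ℕ._≤ count Q? ys) (length-map f (filter P? xs))
    (length-mono-⊆
      (map-unique f (Unique.filter⁺ P? u)
        (λ x∈ y∈ → inj (proj₂ (∈-filter⁻ P? {xs = xs} x∈)) (proj₂ (∈-filter⁻ P? {xs = xs} y∈))))
      (λ z∈ → let (x , x∈ , z≡) = ∈-map⁻ f z∈ in
        ∈-filter⁺ Q? (complete _)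
          (subst Q (sym z≡) (P⇒Q (proj₂ (∈-filter⁻ P? {xs = xs} x∈))))))

-- The images under `f` and under `g` are concatenated. Each half has no repetitions by injectivity,
-- and the halves share no element by the last hypothesis.
count-double : {P : Pred A p} {Q : Pred B q} (P? : Decidable P) (Q? : Decidable Q)
               {xs : List A} {ys : List B} → Unique xs → (∀ y → y ∈ ys) → (f g : A → B) →
               (∀ {x} → P x → Q (f x)) → (∀ {x} → P x → Q (g x)) →
               (∀ {x y} → P x → P y → f x ≡ f y → x ≡ y) →
               (∀ {x y} → P x → P y → g x ≡ g y → x ≡ y) →
               (∀ {x y} → P x → P y → f x ≢ g y) →
               2 * count P? xs ℕ.≤ count Q? ys
count-double {P = P} {Q = Q} P? Q? {xs} {ys} u complete f g P⇒Qf P⇒Qg injf injg f≢g =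
  subst (ℕ._≤ count Q? ys) len (length-mono-⊆ unique sub)
  where
  zs = filter P? xs

  P-of : ∀ {x} → x ∈ zs → P x
  P-of x∈ = proj₂ (∈-filter⁻ P? {xs = xs} x∈)

  unique : Unique (map f zs ++ map g zs)
  unique = Unique.++⁺
    (map-unique f (Unique.filter⁺ P? u) (λ x∈ y∈ → injf (P-of x∈) (P-of y∈)))
    (map-unique g (Unique.filter⁺ P? u) (λ x∈ y∈ → injg (P-of x∈) (P-of y∈)))
    λ (z∈f , z∈g) →
      let (x , x∈ , z≡fx) = ∈-map⁻ f z∈f
          (y , y∈ , z≡gy) = ∈-map⁻ g z∈g
      in f≢g (P-of x∈) (P-of y∈) (trans (sym z≡fx) z≡gy)

  image : ∀ (h : _ → _) → (∀ {x} → P x → Q (h x)) → ∀ {z} → z ∈ map h zs → z ∈ filter Q? ys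
  image h P⇒Q z∈ = let (x , x∈ , z≡) = ∈-map⁻ h z∈ in
    ∈-filter⁺ Q? (complete _) (subst Q (sym z≡) (P⇒Q (P-of x∈)))

  sub : ∀ {z} → z ∈ map f zs ++ map g zs → z ∈ filter Q? ys
  sub z∈ = Sum.[ image f P⇒Qf , image g P⇒Qg ]′ (∈-++⁻ (map f zs) z∈)

  len : length (map f zs ++ map g zs) ≡ 2 * length zs
  len rewrite length-++ (map f zs) {map g zs} | length-map f zs | length-map g zs
            | ℕ.+-identityʳ (length zs) = refl

count-witness : {P : Pred A p} (P? : Decidable P) (xs : List A) → count P? xs ≥ 1 → ∃ P
count-witness P? xs c with filter P? xs in eq
... | y ∷ _ = y , proj₂ (∈-filter⁻ P? {xs = xs} (subst (y ∈_) (sym eq) (here refl)))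

-- Finite ordinals

≮⇒≥ : {i j : Fin n} → ¬ i < j → j ≤ i
≮⇒≥ = ℕ.≮⇒≥

least : {P : Pred (Fin n) p} → Decidable P → ∃ P → ∃ λ k → P k × (∀ j → P j → k ≤ j)
least {n = suc n} P? (k , pk) with P? zero
... | yes p₀ = zero , p₀ , λ _ _ → z≤n
least {n = suc n} P? (zero , pk)  | no ¬p₀ = contradiction pk ¬p₀
least {n = suc n} {P = P} P? (suc k , pk) | no ¬p₀ =
  let (k′ , pk′ , min) = least (P? ∘ suc) (k , pk) in
  suc k′ , pk′ , λ { zero p₀ → contradiction p₀ ¬p₀ ; (suc j) pj → s≤s (min j pj) }

inject₁-mono-< : {i j : Fin n} → i < j → inject₁ i < inject₁ j
inject₁-mono-< {i = i} {j} = subst₂ ℕ._<_ (sym (toℕ-inject₁ i)) (sym (toℕ-inject₁ j))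

inject₁-cancel-< : {i j : Fin n} → inject₁ i < inject₁ j → i < j
inject₁-cancel-< {i = i} {j} = subst₂ ℕ._<_ (toℕ-inject₁ i) (toℕ-inject₁ j)

inject₁<fromℕ : (i : Fin n) → inject₁ i < fromℕ n
inject₁<fromℕ {n} i = subst (toℕ (inject₁ i) ℕ.<_) (sym (toℕ-fromℕ n)) (inject₁ℕ< i)

fromℕ-max : (k : Fin (suc n)) → k ≤ fromℕ n
fromℕ-max {n} k = subst (toℕ k ℕ.≤_) (sym (toℕ-fromℕ n)) (ℕ.≤-pred (toℕ<n k))

snoc : (Fin n → A) → A → Fin (suc n) → A
snoc f x k with view k
... | ‵fromℕ     = x
... | ‵inject₁ i = f i

snoc-inject₁ : (f : Fin n → A) (x : A) (i : Fin n) → snoc f x (inject₁ i) ≡ f i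
snoc-inject₁ f x i rewrite view-inject₁ i = refl

snoc-fromℕ : (f : Fin n → A) (x : A) → snoc f x (fromℕ n) ≡ x
snoc-fromℕ {n} f x rewrite view-fromℕ n = refl

lookup-ext : {u v : Vec A n} → (∀ i → lookup u i ≡ lookup v i) → u ≡ v
lookup-ext {u = u} {v} eq =
  trans (sym (tabulate∘lookup u)) (trans (tabulate-cong eq) (tabulate∘lookup v))

true-ext : {x y : Bool} → (x ≡ true → y ≡ true) → (y ≡ true → x ≡ true) → x ≡ y
true-ext {true}          f g = sym (f refl)
true-ext {false} {true}  f g = g refl
true-ext {false} {false} f g = refl

does⁻ : {P : Set p} (P? : Dec P) → does P? ≡ true → P
does⁻ (yes p) _ = p

-- Matrices and children

entry : Matrix n → Fin n → Fin n → Bool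
entry M i j = lookup (lookup M i) j

matrix : (Fin n → Fin n → Bool) → Matrix n
matrix f = tabulate λ i → tabulate (f i)

entry-matrix : (f : Fin n → Fin n → Bool) → ∀ i j → entry (matrix f) i j ≡ f i j
entry-matrix f i j rewrite lookup∘tabulate (λ i → tabulate (f i)) i = lookup∘tabulate (f i) j

entry-ext : {M N : Matrix n} → (∀ i j → entry M i j ≡ entry N i j) → M ≡ N
entry-ext eq = lookup-ext λ i → lookup-ext (eq i)

module _ (M : Matrix n) where

  HasBelow HasRight : Fin n → Fin n → Set
  HasBelow i j = ∃ λ i′ → i < i′ × Vertex M i′ j
  HasRight i j = ∃ λ j′ → j < j′ × Vertex M i j′

  Xor : Set
  Xor = ∀ i j → Vertex M i j → ¬ IsRoot i j →
        (HasAbove M i j × ¬ HasLeft M i j) ⊎ (¬ HasAbove M i j × HasLeft M i j)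

  children : Fin n → Fin n → List (Fin n × Fin n)
  children i j = filter (λ (k , l) → parent? M i j k l) (cartesianProduct (allFin n) (allFin n))

  children-unique : ∀ i j → Unique (children i j)
  children-unique i j = Unique.filter⁺ (λ (k , l) → parent? M i j k l)
    (Unique.cartesianProduct⁺ (Unique.allFin⁺ n) (Unique.allFin⁺ n))

  ∈-children⁺ : ∀ {i j k l} → Parent M i j k l → (k , l) ∈ children i j
  ∈-children⁺ {i} {j} = ∈-filter⁺ (λ (k , l) → parent? M i j k l)
    (∈-cartesianProduct⁺ (∈-allFin _) (∈-allFin _))

  ∈-children⁻ : ∀ {i j k l} → (k , l) ∈ children i j → Parent M i j k l
  ∈-children⁻ {i} {j} = proj₂ ∘
    ∈-filter⁻ (λ (k , l) → parent? M i j k l) {xs = cartesianProduct (allFin n) (allFin n)}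

  -- If the two vertices differed, the upper one would lie strictly between row `i` and the lower
  -- one, against the maximality of `i`.
  nearestAbove-unique : ∀ {i k k′ j} → Vertex M k j → Vertex M k′ j →
                        NearestAbove M i k j → NearestAbove M i k′ j → k ≡ k′
  nearestAbove-unique {k = k} {k′} v v′ (i<k , _ , max) (i<k′ , _ , max′) with Fin.<-cmp k k′
  ... | tri< k<k′ _ _ = contradiction (max′ k k<k′ v) (ℕ.<⇒≱ i<k)
  ... | tri≈ _ eq _   = eq
  ... | tri> _ _ k′<k = contradiction (max k′ k′<k v′) (ℕ.<⇒≱ i<k′)

  nearestLeft-unique : ∀ {i j l l′} → Vertex M i l → Vertex M i l′ →
                       NearestLeft M j i l → NearestLeft M j i l′ → l ≡ l′
  nearestLeft-unique {l = l} {l′} v v′ (j<l , _ , max) (j<l′ , _ , max′) with Fin.<-cmp l l′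
  ... | tri< l<l′ _ _ = contradiction (max′ l l<l′ v) (ℕ.<⇒≱ j<l)
  ... | tri≈ _ eq _   = eq
  ... | tri> _ _ l′<l = contradiction (max l′ l′<l v′) (ℕ.<⇒≱ j<l′)

  child-position : ∀ {i j k l} → Parent M i j k l → HasBelow i j ⊎ HasRight i j
  child-position (v , _ , inj₁ (refl , i<k , _))     = inj₁ (_ , i<k , v)
  child-position (v , _ , inj₂ (_ , refl , j<l , _)) = inj₂ (_ , j<l , v)

  -- The first vertex below in the column is a child: a vertex with something above it has its
  -- parent in its column, and minimality leaves nothing in between.
  childBelow : ∀ {i j} → Vertex M i j → HasBelow i j → ∃ λ k → i < k × Parent M i j k j
  childBelow {i} {j} v below
    with k , (i<k , vk) , min ← least (λ k → (i Fin.<? k) ×-dec vertex? M k j) below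
    = k , i<k , vk , (λ (k≡0 , _) → ℕ.n≮0 (subst (toℕ i ℕ.<_) k≡0 i<k)) ,
      inj₁ (refl , i<k , v , λ k′ k′<k v′ → ≮⇒≥ λ i<k′ → ℕ.<⇒≱ k′<k (min k′ (i<k′ , v′)))

  -- The first vertex to the right is a child only if nothing lies above it. This is where `xor`
  -- enters: `(i , j)` already lies to its left.
  childRight : Xor → ∀ {i j} → Vertex M i j → HasRight i j → ∃ λ l → j < l × Parent M i j i l
  childRight xor {i} {j} v right
    with l , (j<l , vl) , min ← least (λ l → (j Fin.<? l) ×-dec vertex? M i l) right
    = l , j<l , vl , nonRoot ,
      inj₂ (noAbove (xor i l vl nonRoot) , refl , j<l , v ,
            λ l′ l′<l v′ → ≮⇒≥ λ j<l′ → ℕ.<⇒≱ l′<l (min l′ (j<l′ , v′)))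
    where
    nonRoot : ¬ IsRoot i l
    nonRoot (_ , l≡0) = ℕ.n≮0 (subst (toℕ j ℕ.<_) l≡0 j<l)
    noAbove : _ → ¬ HasAbove M i l
    noAbove (inj₁ (_ , ¬left))  = contradiction (j , j<l , v) ¬left
    noAbove (inj₂ (¬above , _)) = ¬above

  #children≡0⁻ : Xor → ∀ {i j} → Vertex M i j → #children M i j ≡ 0 → ¬ HasBelow i j × ¬ HasRight i j
  #children≡0⁻ xor {i} {j} v eq =
    (λ below → none (proj₂ (proj₂ (childBelow v below)))) ,
    (λ right → none (proj₂ (proj₂ (childRight xor v right))))
    where
    none : ∀ {k l} → ¬ Parent M i j k l
    none par = ℕ.n≮0 (subst (0 ℕ.<_) eq (∈-length (∈-children⁺ par)))

  #children≡0⁺ : ∀ {i j} → ¬ HasBelow i j → ¬ HasRight i j → #children M i j ≡ 0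
  #children≡0⁺ {i} {j} ¬below ¬right = ℕ.n≤0⇒n≡0 (length-mono-⊆ {ys = []} (children-unique i j)
    λ c∈ → ⊥-elim (Sum.[ ¬below , ¬right ]′ (child-position (∈-children⁻ c∈))))

  -- Two distinct children cannot both be below or both be to the right, by uniqueness of the vertex
  -- with a given nearest predecessor; so there is one on each side.
  #children≡2⁻ : ∀ {i j} → #children M i j ≡ 2 → HasBelow i j × HasRight i j
  #children≡2⁻ {i} {j} = go (children i j) (children-unique i j) ∈-children⁻
    where
    go : ∀ cs → Unique cs → (∀ {k l} → (k , l) ∈ cs → Parent M i j k l) →
         length cs ≡ 2 → HasBelow i j × HasRight i j
    go (_ ∷ _ ∷ []) ((c≢d ∷ _) ∷ _) par _ with par (here refl) | par (there (here refl))
    ... | v , _ , inj₁ (refl , near) | v′ , _ , inj₁ (refl , near′) =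
      contradiction (cong (_, j) (nearestAbove-unique v v′ near near′)) c≢d
    ... | v , _ , inj₁ (refl , near) | v′ , _ , inj₂ (_ , refl , near′) =
      (_ , proj₁ near , v) , (_ , proj₁ near′ , v′)
    ... | v , _ , inj₂ (_ , refl , near) | v′ , _ , inj₁ (refl , near′) =
      (_ , proj₁ near′ , v′) , (_ , proj₁ near , v)
    ... | v , _ , inj₂ (_ , refl , near) | v′ , _ , inj₂ (_ , refl , near′) =
      contradiction (cong (i ,_) (nearestLeft-unique v v′ near near′)) c≢d

  -- The first vertex below and the first to the right are children, and by uniqueness every child
  -- is one of these two. Comparison with this two-element list bounds the length from both sides.
  #children≡2⁺ : Xor → ∀ {i j} → Vertex M i j → HasBelow i j → HasRight i j → #children M i j ≡ 2
  #children≡2⁺ xor {i} {j} v below right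
    with k , i<k , pk ← childBelow v below
       | l , j<l , pl ← childRight xor v right
    = ℕ.≤-antisym (length-mono-⊆ (children-unique i j) (λ c∈ → two (∈-children⁻ c∈)))
        (length-mono-⊆ (((λ eq → Fin.<-irrefl (cong proj₂ eq) j<l) ∷ []) ∷ [] ∷ [])
          λ { (here refl) → ∈-children⁺ pk ; (there (here refl)) → ∈-children⁺ pl })
    where
    belowEq : ∀ {k k′ l} → Parent M i j k j → i < k → Parent M i j k′ l → l ≡ j → k ≡ k′
    belowEq (v₁ , _ , inj₁ (_ , n₁)) _ (v₂ , _ , inj₁ (_ , n₂)) refl =
      nearestAbove-unique v₁ v₂ n₁ n₂
    belowEq (_ , _ , inj₂ (_ , _ , j<j , _)) _ _ _ = contradiction j<j (Fin.<-irrefl refl)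
    belowEq _ _ (_ , _ , inj₂ (_ , _ , j<l , _)) refl = contradiction j<l (Fin.<-irrefl refl)

    rightEq : ∀ {l k′ l′} → Parent M i j i l → Parent M i j k′ l′ → k′ ≡ i → l ≡ l′
    rightEq (_ , _ , inj₁ (_ , i<i , _)) _ _ = contradiction i<i (Fin.<-irrefl refl)
    rightEq _ (_ , _ , inj₁ (_ , i<k , _)) refl = contradiction i<k (Fin.<-irrefl refl)
    rightEq (v₁ , _ , inj₂ (_ , _ , n₁)) (v₂ , _ , inj₂ (_ , _ , n₂)) refl =
      nearestLeft-unique v₁ v₂ n₁ n₂

    two : ∀ {k′ l′} → Parent M i j k′ l′ → (k′ , l′) ∈ _ ∷ _ ∷ []
    two par@(_ , _ , inj₁ (refl , _)) = here (cong (_, j) (sym (belowEq pk i<k par refl)))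
    two par@(_ , _ , inj₂ (_ , refl , _)) = there (here (cong (i ,_) (sym (rightEq pl par refl))))

-- Complete non-ambiguous matrices with a prescribed leaf matrix

-- Child counts are replaced by the existence of vertices below and to the right: none for a leaf,
-- both for an inner vertex. These conditions are easy to follow when a row and a column are added
-- or removed.
record CNMWithLeaves (M : Matrix n) (σ : Vec (Fin n) n) : Set where
  field
    root  : ∃ λ i → ∃ λ j → IsRoot i j × Vertex M i j
    xor   : Xor M
    leaf  : ∀ i → Vertex M i (lookup σ i) × ¬ HasBelow M i (lookup σ i) × ¬ HasRight M i (lookup σ i)
    inner : ∀ i j → Vertex M i j → lookup σ i ≢ j → HasBelow M i j × HasRight M i j

fromCNM : {M : Matrix n} (σ : Vec (Fin n) n) → IsCNM M → leafMatrix M ≡ permutationMatrix σ →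
          CNMWithLeaves M σ
fromCNM {M = M} σ cnm eq = record
  { root  = root
  ; xor   = xor
  ; leaf  = λ i → let (v , none) = leafAt i in v , #children≡0⁻ M xor v none
  ; inner = λ i j v σi≢j → #children≡2⁻ M (two i j v σi≢j (complete i j v))
  }
  where
  open IsCNM cnm

  does-eq : ∀ i j → does (leaf? M i j) ≡ does (lookup σ i ≟ᶠ j)
  does-eq i j = trans (sym (entry-matrix (λ i j → does (leaf? M i j)) i j))
    (trans (cong (λ N → entry N i j) eq) (entry-matrix (λ i j → does (lookup σ i ≟ᶠ j)) i j))

  leafAt : ∀ i → Leaf M i (lookup σ i)
  leafAt i = does⁻ (leaf? M i _) (trans (does-eq i _) (dec-true (lookup σ i ≟ᶠ _) refl))

  two : ∀ i j → Vertex M i j → lookup σ i ≢ j →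
        #children M i j ≡ 0 ⊎ #children M i j ≡ 2 → #children M i j ≡ 2
  two i j v σi≢j (inj₁ none) = contradiction
    (does⁻ (lookup σ i ≟ᶠ j) (trans (sym (does-eq i j)) (dec-true (leaf? M i j) (v , none)))) σi≢j
  two i j v σi≢j (inj₂ eq₂)  = eq₂

-- Every row contains its leaf, and so does every column by surjectivity of `σ`. A vertex off the
-- permutation has a vertex below it, hence a child, so the leaves are exactly the positions of `σ`.
toCNM : {M : Matrix n} (σ : Vec (Fin n) n) → IsPermutation σ → CNMWithLeaves M σ →
        IsCNM M × leafMatrix M ≡ permutationMatrix σ
toCNM {M = M} σ (_ , surj) spec =
  isCNM root xor (λ i → lookup σ i , proj₁ (leaf i)) column complete ,
  entry-ext λ i j → trans (entry-matrix (λ i j → does (leaf? M i j)) i j)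
    (trans (true-ext
      (λ t → dec-true (lookup σ i ≟ᶠ j) (leaf⇒≡ i j (does⁻ (leaf? M i j) t)))
      (λ t → dec-true (leaf? M i j) (≡⇒leaf i j (does⁻ (lookup σ i ≟ᶠ j) t))))
    (sym (entry-matrix (λ i j → does (lookup σ i ≟ᶠ j)) i j)))
  where
  open CNMWithLeaves spec

  ≡⇒leaf : ∀ i j → lookup σ i ≡ j → Leaf M i j
  ≡⇒leaf i j refl = let (v , ¬below , ¬right) = leaf i in v , #children≡0⁺ M ¬below ¬right

  leaf⇒≡ : ∀ i j → Leaf M i j → lookup σ i ≡ j
  leaf⇒≡ i j (v , none) with lookup σ i ≟ᶠ j
  ... | yes eq   = eq
  ... | no σi≢j = contradiction (proj₁ (inner i j v σi≢j)) (proj₁ (#children≡0⁻ M xor v none))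

  column : ∀ j → ∃ λ i → Vertex M i j
  column j = let (i , eq) = surj j in i , subst (Vertex M i) (eq refl) (proj₁ (leaf i))

  complete : ∀ i j → Vertex M i j → #children M i j ≡ 0 ⊎ #children M i j ≡ 2
  complete i j v with lookup σ i ≟ᶠ j
  ... | yes eq   = inj₁ (proj₂ (≡⇒leaf i j eq))
  ... | no σi≢j = let (below , right) = inner i j v σi≢j in inj₂ (#children≡2⁺ M xor v below right)

-- Splitting a leaf

-- This is `σ`, extended by a fixed last point, composed with the transposition of `i` and the new
-- last position.
splitPerm : Fin n → Vec (Fin n) n → Vec (Fin (suc n)) (suc n)
splitPerm {n} i σ = tabulate (snoc
  (λ a → if does (a ≟ᶠ i) then fromℕ n else inject₁ (lookup σ a))
  (inject₁ (lookup σ i)))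

module _ (i : Fin n) (σ : Vec (Fin n) n) where

  private
    top : Fin n → Fin (suc n)
    top a = if does (a ≟ᶠ i) then fromℕ n else inject₁ (lookup σ a)

    lookup-top : ∀ a → lookup (splitPerm i σ) (inject₁ a) ≡ top a
    lookup-top a = trans (lookup∘tabulate (snoc top (inject₁ (lookup σ i))) (inject₁ a))
      (snoc-inject₁ top (inject₁ (lookup σ i)) a)

  splitPerm-at : lookup (splitPerm i σ) (inject₁ i) ≡ fromℕ n
  splitPerm-at = trans (lookup-top i) (cong (if_then fromℕ n else inject₁ (lookup σ i)) (dec-true (i ≟ᶠ i) refl))

  splitPerm-other : ∀ {a} → a ≢ i → lookup (splitPerm i σ) (inject₁ a) ≡ inject₁ (lookup σ a)
  splitPerm-other {a} a≢i =
    trans (lookup-top a) (cong (if_then fromℕ n else inject₁ (lookup σ a)) (dec-false (a ≟ᶠ i) a≢i))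

  splitPerm-last : lookup (splitPerm i σ) (fromℕ n) ≡ inject₁ (lookup σ i)
  splitPerm-last = trans (lookup∘tabulate (snoc top (inject₁ (lookup σ i))) (fromℕ n))
    (snoc-fromℕ top (inject₁ (lookup σ i)))

  splitPerm-fromℕ⁻ : ∀ x → lookup (splitPerm i σ) x ≡ fromℕ n → x ≡ inject₁ i
  splitPerm-fromℕ⁻ x eq with view x
  ... | ‵fromℕ     = contradiction (trans (sym eq) splitPerm-last) fromℕ≢inject₁
  ... | ‵inject₁ a with a ≟ᶠ i
  ...   | yes refl = refl
  ...   | no a≢i   = contradiction (trans (sym eq) (splitPerm-other a≢i)) fromℕ≢inject₁

  splitPerm-inject₁⁻ : ∀ {a b} → lookup (splitPerm i σ) (inject₁ a) ≡ inject₁ b → a ≢ i × lookup σ a ≡ b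
  splitPerm-inject₁⁻ {a} eq with a ≟ᶠ i
  ... | yes refl = contradiction (trans (sym splitPerm-at) eq) fromℕ≢inject₁
  ... | no a≢i   = a≢i , inject₁-injective (trans (sym (splitPerm-other a≢i)) eq)

  splitPerm-isPermutation : IsPermutation σ → IsPermutation (splitPerm i σ)
  splitPerm-isPermutation (inj , surj) = (λ {x} {y} → injective x y) , λ y →
    let (x , eq) = surjective y in x , λ { refl → eq }
    where
    injective : ∀ x y → lookup (splitPerm i σ) x ≡ lookup (splitPerm i σ) y → x ≡ y
    injective x y eq with view x | view y
    ... | ‵fromℕ | ‵fromℕ = refl
    ... | ‵fromℕ | ‵inject₁ b =
      let (b≢i , σb≡σi) = splitPerm-inject₁⁻ {b} (trans (sym eq) splitPerm-last)
      in contradiction (inj σb≡σi) b≢i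
    ... | ‵inject₁ a | ‵fromℕ =
      let (a≢i , σa≡σi) = splitPerm-inject₁⁻ {a} (trans eq splitPerm-last)
      in contradiction (inj σa≡σi) a≢i
    ... | ‵inject₁ a | ‵inject₁ b with b ≟ᶠ i
    ...   | yes refl = splitPerm-fromℕ⁻ (inject₁ a) (trans eq splitPerm-at)
    ...   | no b≢i   = cong inject₁ (inj (proj₂ (splitPerm-inject₁⁻ {a} (trans eq (splitPerm-other b≢i)))))

    surjective : ∀ y → ∃ λ x → lookup (splitPerm i σ) x ≡ y
    surjective y with view y
    ... | ‵fromℕ     = inject₁ i , splitPerm-at
    ... | ‵inject₁ b with surj b
    ...   | a , σa≡ with a ≟ᶠ i
    -- The value formerly taken at `i` has moved to the new last position.
    ...     | yes refl = fromℕ n , trans splitPerm-last (cong inject₁ (σa≡ refl))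
    ...     | no a≢i   = inject₁ a , trans (splitPerm-other a≢i) (cong inject₁ (σa≡ refl))

-- The index `i` can be read off as the position of the largest value, and `σ i` as the last value;
-- all other values stay in place.
splitPerm-injective : ∀ {i j} {σ τ : Vec (Fin n) n} → splitPerm i σ ≡ splitPerm j τ → σ ≡ τ
splitPerm-injective {n = n} {i} {j} {σ} {τ} eq = lookup-ext pointwise
  where
  i≡j : i ≡ j
  i≡j = inject₁-injective (splitPerm-fromℕ⁻ j τ (inject₁ i)
    (trans (cong (λ ρ → lookup ρ (inject₁ i)) (sym eq)) (splitPerm-at i σ)))

  pointwise : ∀ a → lookup σ a ≡ lookup τ a
  pointwise a with a ≟ᶠ i
  ... | yes refl = inject₁-injective (trans (sym (splitPerm-last i σ))
    (trans (cong (λ ρ → lookup ρ (fromℕ n)) eq)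
      (trans (splitPerm-last j τ) (cong (inject₁ ∘ lookup τ) (sym i≡j)))))
  ... | no a≢i   = inject₁-injective (trans (sym (splitPerm-other i σ a≢i))
    (trans (cong (λ ρ → lookup ρ (inject₁ a)) eq) (splitPerm-other j τ (λ a≡j → a≢i (trans a≡j (sym i≡j))))))

-- A relation instead of the function `extend`, so that the same lemmas serve both the constructed
-- matrix and an arbitrary matrix once it is shown to have this shape.
record Extends (M′ : Matrix (suc n)) (M : Matrix n) (i j : Fin n) : Set where
  field
    block  : ∀ a b → entry M′ (inject₁ a) (inject₁ b) ≡ entry M a b
    right⁺ : Vertex M′ (inject₁ i) (fromℕ n)
    right⁻ : ∀ {a} → Vertex M′ (inject₁ a) (fromℕ n) → a ≡ i
    below⁺ : Vertex M′ (fromℕ n) (inject₁ j)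
    below⁻ : ∀ {b} → Vertex M′ (fromℕ n) (inject₁ b) → b ≡ j
    corner : ¬ Vertex M′ (fromℕ n) (fromℕ n)

extend : Matrix n → Fin n → Fin n → Matrix (suc n)
extend M i j = matrix (snoc
  (λ a → snoc (entry M a) (does (a ≟ᶠ i)))
  (snoc (λ b → does (b ≟ᶠ j)) false))

extend-extends : (M : Matrix n) (i j : Fin n) → Extends (extend M i j) M i j
extend-extends {n} M i j = record
  { block  = block
  ; right⁺ = trans (right i) (dec-true (i ≟ᶠ i) refl)
  ; right⁻ = λ {a} v → does⁻ (a ≟ᶠ i) (trans (sym (right a)) v)
  ; below⁺ = trans (below j) (dec-true (j ≟ᶠ j) refl)
  ; below⁻ = λ {b} v → does⁻ (b ≟ᶠ j) (trans (sym (below b)) v)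
  ; corner = λ v → contradiction (trans (sym v) corner) λ ()
  }
  where
  top : Fin n → Fin (suc n) → Bool
  top a = snoc (entry M a) (does (a ≟ᶠ i))

  bottom : Fin (suc n) → Bool
  bottom = snoc (λ b → does (b ≟ᶠ j)) false

  topRow : ∀ a y → entry (extend M i j) (inject₁ a) y ≡ top a y
  topRow a y = trans (entry-matrix (snoc top bottom) (inject₁ a) y)
    (cong (λ row → row y) (snoc-inject₁ top bottom a))

  bottomRow : ∀ y → entry (extend M i j) (fromℕ n) y ≡ bottom y
  bottomRow y = trans (entry-matrix (snoc top bottom) (fromℕ n) y)
    (cong (λ row → row y) (snoc-fromℕ top bottom))

  block : ∀ a b → entry (extend M i j) (inject₁ a) (inject₁ b) ≡ entry M a b
  block a b = trans (topRow a (inject₁ b)) (snoc-inject₁ (entry M a) _ b)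

  right : ∀ a → entry (extend M i j) (inject₁ a) (fromℕ n) ≡ does (a ≟ᶠ i)
  right a = trans (topRow a (fromℕ n)) (snoc-fromℕ (entry M a) _)

  below : ∀ b → entry (extend M i j) (fromℕ n) (inject₁ b) ≡ does (b ≟ᶠ j)
  below b = trans (bottomRow (inject₁ b)) (snoc-inject₁ (λ b → does (b ≟ᶠ j)) false b)

  corner : entry (extend M i j) (fromℕ n) (fromℕ n) ≡ false
  corner = trans (bottomRow (fromℕ n)) (snoc-fromℕ (λ b → does (b ≟ᶠ j)) false)

-- The block together with `i` and `j` determines every entry; this gives the injectivity of
-- `restrict` on matrices of this shape.
extends-unique : ∀ {M′ N′ : Matrix (suc n)} {M i j} → Extends M′ M i j → Extends N′ M i j → M′ ≡ N′
extends-unique {M′ = M′} {N′} E F = entry-ext eq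
  where
  module E = Extends E
  module F = Extends F
  eq : ∀ x y → entry M′ x y ≡ entry N′ x y
  eq x y with view x | view y
  ... | ‵inject₁ a | ‵inject₁ b = trans (E.block a b) (sym (F.block a b))
  ... | ‵inject₁ a | ‵fromℕ     =
    true-ext (λ v → subst (λ a → Vertex N′ (inject₁ a) _) (sym (E.right⁻ v)) F.right⁺)
             (λ v → subst (λ a → Vertex M′ (inject₁ a) _) (sym (F.right⁻ v)) E.right⁺)
  ... | ‵fromℕ     | ‵inject₁ b =
    true-ext (λ v → subst (λ b → Vertex N′ _ (inject₁ b)) (sym (E.below⁻ v)) F.below⁺)
             (λ v → subst (λ b → Vertex M′ _ (inject₁ b)) (sym (F.below⁻ v)) E.below⁺)
  ... | ‵fromℕ     | ‵fromℕ     =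
    true-ext (λ v → contradiction v E.corner) (λ v → contradiction v F.corner)

restrict : Matrix (suc n) → Matrix n
restrict M = matrix λ a b → entry M (inject₁ a) (inject₁ b)

restrict-extends : ∀ {M′ : Matrix (suc n)} {M i j} → Extends M′ M i j → restrict M′ ≡ M
restrict-extends {M′ = M′} E = entry-ext λ a b →
  trans (entry-matrix (λ a b → entry M′ (inject₁ a) (inject₁ b)) a b) (Extends.block E a b)

module _ {M′ : Matrix (suc n)} {M : Matrix n} {i j : Fin n} (E : Extends M′ M i j) where
  open Extends E

  vertex⁺ : ∀ {a b} → Vertex M a b → Vertex M′ (inject₁ a) (inject₁ b)
  vertex⁺ v = trans (block _ _) v

  vertex⁻ : ∀ {a b} → Vertex M′ (inject₁ a) (inject₁ b) → Vertex M a b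
  vertex⁻ v = trans (sym (block _ _)) v

  root⁺ : ∀ {a b : Fin n} → IsRoot a b → IsRoot (inject₁ a) (inject₁ b)
  root⁺ {a} {b} (a≡0 , b≡0) = trans (toℕ-inject₁ a) a≡0 , trans (toℕ-inject₁ b) b≡0

  root⁻ : ∀ {a b : Fin n} → IsRoot (inject₁ a) (inject₁ b) → IsRoot a b
  root⁻ {a} {b} (a≡0 , b≡0) = trans (sym (toℕ-inject₁ a)) a≡0 , trans (sym (toℕ-inject₁ b)) b≡0

  above⁺ : ∀ {a b} → HasAbove M a b → HasAbove M′ (inject₁ a) (inject₁ b)
  above⁺ (k , k<a , v) = inject₁ k , inject₁-mono-< k<a , vertex⁺ v

  above⁻ : ∀ {a b} → HasAbove M′ (inject₁ a) (inject₁ b) → HasAbove M a b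
  above⁻ (k , k<a , v) with view k
  ... | ‵fromℕ     = contradiction (fromℕ-max _) (ℕ.<⇒≱ k<a)
  ... | ‵inject₁ c = c , inject₁-cancel-< k<a , vertex⁻ v

  left⁺ : ∀ {a b} → HasLeft M a b → HasLeft M′ (inject₁ a) (inject₁ b)
  left⁺ (l , l<b , v) = inject₁ l , inject₁-mono-< l<b , vertex⁺ v

  left⁻ : ∀ {a b} → HasLeft M′ (inject₁ a) (inject₁ b) → HasLeft M a b
  left⁻ (l , l<b , v) with view l
  ... | ‵fromℕ     = contradiction (fromℕ-max _) (ℕ.<⇒≱ l<b)
  ... | ‵inject₁ d = d , inject₁-cancel-< l<b , vertex⁻ v

  hasBelow⁺ : ∀ {a b} → HasBelow M a b → HasBelow M′ (inject₁ a) (inject₁ b)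
  hasBelow⁺ (k , a<k , v) = inject₁ k , inject₁-mono-< a<k , vertex⁺ v

  -- The new row and column come last, so nothing changes above or to the left of a block position.
  -- Below, the only possible newcomer is the single vertex of the new row, which forces `b ≡ j`.
  hasBelow⁻ : ∀ {a b} → HasBelow M′ (inject₁ a) (inject₁ b) → HasBelow M a b ⊎ b ≡ j
  hasBelow⁻ (k , a<k , v) with view k
  ... | ‵fromℕ     = inj₂ (below⁻ v)
  ... | ‵inject₁ c = inj₁ (c , inject₁-cancel-< a<k , vertex⁻ v)

  hasRight⁺ : ∀ {a b} → HasRight M a b → HasRight M′ (inject₁ a) (inject₁ b)
  hasRight⁺ (l , b<l , v) = inject₁ l , inject₁-mono-< b<l , vertex⁺ v

  hasRight⁻ : ∀ {a b} → HasRight M′ (inject₁ a) (inject₁ b) → HasRight M a b ⊎ a ≡ i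
  hasRight⁻ (l , b<l , v) with view l
  ... | ‵fromℕ     = inj₂ (right⁻ v)
  ... | ‵inject₁ d = inj₁ (d , inject₁-cancel-< b<l , vertex⁻ v)

  xor⁻ : Xor M′ → Xor M
  xor⁻ xor a b v ¬root with xor (inject₁ a) (inject₁ b) (vertex⁺ v) (¬root ∘ root⁻ {a} {b})
  ... | inj₁ (above , ¬left) = inj₁ (above⁻ above , ¬left ∘ left⁺)
  ... | inj₂ (¬above , left) = inj₂ (¬above ∘ above⁺ , left⁻ left)

  -- Each new vertex sees `(i , j)` on one side, above or to the left, and nothing on the other,
  -- since it is alone in its new row or column.
  xor⁺ : Vertex M i j → Xor M → Xor M′
  xor⁺ vij xor x y v ¬root with view x | view y
  ... | ‵fromℕ | ‵fromℕ = contradiction v corner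
  ... | ‵fromℕ | ‵inject₁ b rewrite below⁻ v =
    inj₁ ((inject₁ i , inject₁<fromℕ i , vertex⁺ vij) , ¬left)
    where
    ¬left : ¬ HasLeft M′ (fromℕ n) (inject₁ j)
    ¬left (l , l<j , v′) with view l
    ... | ‵fromℕ     = corner v′
    ... | ‵inject₁ d = Fin.<-irrefl (below⁻ v′) (inject₁-cancel-< l<j)
  ... | ‵inject₁ a | ‵fromℕ rewrite right⁻ v =
    inj₂ (¬above , (inject₁ j , inject₁<fromℕ j , vertex⁺ vij))
    where
    ¬above : ¬ HasAbove M′ (inject₁ i) (fromℕ n)
    ¬above (k , k<i , v′) with view k
    ... | ‵fromℕ     = corner v′
    ... | ‵inject₁ c = Fin.<-irrefl (right⁻ v′) (inject₁-cancel-< k<i)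
  ... | ‵inject₁ a | ‵inject₁ b with xor a b (vertex⁻ v) (¬root ∘ root⁺ {a} {b})
  ...   | inj₁ (above , ¬left) = inj₁ (above⁺ above , ¬left ∘ left⁻)
  ...   | inj₂ (¬above , left) = inj₂ (¬above ∘ above⁻ , left⁺ left)

-- The two new vertices become leaves and `(i , lookup σ i)` becomes inner; every other vertex keeps
-- its status.
split⁺ : ∀ {M′ : Matrix (suc n)} {M : Matrix n} σ i → IsPermutation σ →
         Extends M′ M i (lookup σ i) → CNMWithLeaves M σ → CNMWithLeaves M′ (splitPerm i σ)
split⁺ {n = n} {M′} {M} σ i (inj , _) E spec = record
  { root  = let (a , b , r , v) = root in inject₁ a , inject₁ b , root⁺ E {a} {b} r , vertex⁺ E v
  ; xor   = xor⁺ E (proj₁ (leaf i)) xor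
  ; leaf  = leaf′
  ; inner = inner′
  }
  where
  open CNMWithLeaves spec
  open Extends E
  j = lookup σ i

  IsLeaf : Fin (suc n) → Fin (suc n) → Set
  IsLeaf x y = Vertex M′ x y × ¬ HasBelow M′ x y × ¬ HasRight M′ x y

  leafRight : IsLeaf (inject₁ i) (fromℕ n)
  leafRight = right⁺ , ¬below , λ (l , last<l , _) → contradiction (fromℕ-max l) (ℕ.<⇒≱ last<l)
    where
    ¬below : ¬ HasBelow M′ (inject₁ i) (fromℕ n)
    ¬below (k , i<k , v) with view k
    ... | ‵fromℕ     = corner v
    ... | ‵inject₁ c = Fin.<-irrefl (sym (right⁻ v)) (inject₁-cancel-< i<k)

  leafBelow : IsLeaf (fromℕ n) (inject₁ j)
  leafBelow = below⁺ , (λ (k , last<k , _) → contradiction (fromℕ-max k) (ℕ.<⇒≱ last<k)) , ¬right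
    where
    ¬right : ¬ HasRight M′ (fromℕ n) (inject₁ j)
    ¬right (l , j<l , v) with view l
    ... | ‵fromℕ     = corner v
    ... | ‵inject₁ d = Fin.<-irrefl (sym (below⁻ v)) (inject₁-cancel-< j<l)

  leafBlock : ∀ {a} → a ≢ i → IsLeaf (inject₁ a) (inject₁ (lookup σ a))
  leafBlock {a} a≢i = let (v , ¬below , ¬right) = leaf a in
    vertex⁺ E v ,
    -- The new row could only add a vertex below this leaf if it shared the column of the split
    -- leaf, which injectivity of `σ` excludes.
    (λ below → Sum.[ ¬below , (λ σa≡j → a≢i (inj {a} {i} σa≡j)) ]′ (hasBelow⁻ E below)) ,
    (λ right → Sum.[ ¬right , a≢i ]′ (hasRight⁻ E right))

  leaf′ : ∀ x → IsLeaf x (lookup (splitPerm i σ) x)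
  leaf′ x with view x
  ... | ‵fromℕ     = subst (IsLeaf _) (sym (splitPerm-last i σ)) leafBelow
  ... | ‵inject₁ a with a ≟ᶠ i
  ...   | yes refl = subst (IsLeaf _) (sym (splitPerm-at i σ)) leafRight
  ...   | no a≢i   = subst (IsLeaf _) (sym (splitPerm-other i σ a≢i)) (leafBlock a≢i)

  inner′ : ∀ x y → Vertex M′ x y → lookup (splitPerm i σ) x ≢ y → HasBelow M′ x y × HasRight M′ x y
  inner′ x y v ≢y with view x | view y
  ... | ‵fromℕ     | ‵fromℕ     = contradiction v corner
  ... | ‵fromℕ     | ‵inject₁ b =
    contradiction (trans (splitPerm-last i σ) (cong inject₁ (sym (below⁻ v)))) ≢y
  ... | ‵inject₁ a | ‵fromℕ     =
    contradiction (trans (cong (lookup (splitPerm i σ) ∘ inject₁) (right⁻ v)) (splitPerm-at i σ)) ≢y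
  ... | ‵inject₁ a | ‵inject₁ b with lookup σ a ≟ᶠ b
  ...   | no σa≢b =
    let (below , right) = inner a b (vertex⁻ E v) σa≢b in hasBelow⁺ E below , hasRight⁺ E right
  ...   | yes refl with a ≟ᶠ i
  ...     | no a≢i   = contradiction (splitPerm-other i σ a≢i) ≢y
  -- The former leaf: the two new vertices lie below it and to its right.
  ...     | yes refl = (fromℕ n , inject₁<fromℕ a , below⁺) , (fromℕ n , inject₁<fromℕ j , right⁺)

-- Undoing a split at a leaf in the last row or the last column

-- A common condition for both choices of the split leaf, so that the inverse construction is
-- carried out once.
Extremal : Fin n → Vec (Fin n) n → Set
Extremal {n} i σ = ((k : Fin n) → k ≤ i) ⊎ ((l : Fin n) → l ≤ lookup σ i)

module _ (σ : Vec (Fin n) n) (i : Fin n) {M′ : Matrix (suc n)}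
         (σ-perm : IsPermutation σ) (extremal : Extremal i σ)
         (spec : CNMWithLeaves M′ (splitPerm i σ)) where

  open CNMWithLeaves spec
  private
    j  = lookup σ i
    σ′ = splitPerm i σ

  -- An inner vertex needs a vertex below it, which the last row cannot offer; so its only vertex is
  -- its leaf.
  lastRow : ∀ y → Vertex M′ (fromℕ n) y → y ≡ inject₁ j
  lastRow y v with lookup σ′ (fromℕ n) ≟ᶠ y
  ... | yes eq = trans (sym eq) (splitPerm-last i σ)
  ... | no ≢y  = let ((k , last<k , _) , _) = inner (fromℕ n) y v ≢y in
    contradiction (fromℕ-max k) (ℕ.<⇒≱ last<k)

  lastColumn : ∀ x → Vertex M′ x (fromℕ n) → x ≡ inject₁ i
  lastColumn x v with lookup σ′ x ≟ᶠ fromℕ n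
  ... | yes eq = splitPerm-fromℕ⁻ i σ x eq
  ... | no ≢y  = let (_ , (l , last<l , _)) = inner x (fromℕ n) v ≢y in
    contradiction (fromℕ-max l) (ℕ.<⇒≱ last<l)

  rightLeaf : Vertex M′ (inject₁ i) (fromℕ n)
  rightLeaf = subst (Vertex M′ (inject₁ i)) (splitPerm-at i σ) (proj₁ (leaf (inject₁ i)))

  belowLeaf : Vertex M′ (fromℕ n) (inject₁ j)
  belowLeaf = subst (Vertex M′ (fromℕ n)) (splitPerm-last i σ) (proj₁ (leaf (fromℕ n)))

  toℕ-fromℕ≢0 : toℕ (fromℕ n) ≢ 0
  toℕ-fromℕ≢0 eq = ℕ.n≮0 (subst (toℕ (inject₁ i) ℕ.<_) eq (inject₁<fromℕ i))

  -- If i is the last row, the parent of the new leaf in the last column lies in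
  -- row i, and its other child is forced into the new row, whose only vertex is
  -- in column j.  If j is the last column, the roles of rows and columns are swapped.

  splitVertex : Vertex M′ (inject₁ i) (inject₁ j)
  splitVertex = Sum.[ lowest , rightmost ]′ extremal
    where
    lowest : ((k : Fin n) → k ≤ i) → Vertex M′ (inject₁ i) (inject₁ j)
    lowest i-max with xor (inject₁ i) (fromℕ n) rightLeaf (λ (_ , y≡0) → toℕ-fromℕ≢0 y≡0)
    ... | inj₁ ((k , k<i , v) , _) = contradiction k<i (Fin.<-irrefl (lastColumn k v))
    ... | inj₂ (_ , (l , l<last , v)) with inner (inject₁ i) l v
        (λ eq → Fin.<-irrefl (trans (sym eq) (splitPerm-at i σ)) l<last)
    ...   | (k , i<k , v′) , _ with view k
    ...     | ‵fromℕ     = subst (Vertex M′ (inject₁ i)) (lastRow l v′) v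
    ...     | ‵inject₁ c = contradiction (i-max c) (ℕ.<⇒≱ (inject₁-cancel-< i<k))

    rightmost : ((l : Fin n) → l ≤ j) → Vertex M′ (inject₁ i) (inject₁ j)
    rightmost j-max with xor (fromℕ n) (inject₁ j) belowLeaf (λ (x≡0 , _) → toℕ-fromℕ≢0 x≡0)
    ... | inj₂ (_ , (l , l<j , v)) = contradiction l<j (Fin.<-irrefl (lastRow l v))
    ... | inj₁ ((k , k<last , v) , _) with inner k (inject₁ j) v
        (λ eq → Fin.<-irrefl (proj₁ σ′-perm (trans eq (sym (splitPerm-last i σ)))) k<last)
      where σ′-perm = splitPerm-isPermutation i σ σ-perm
    ...   | _ , (l , j<l , v′) with view l
    ...     | ‵fromℕ     = subst (λ x → Vertex M′ x (inject₁ j)) (lastColumn k v′) v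
    ...     | ‵inject₁ d = contradiction (j-max d) (ℕ.<⇒≱ (inject₁-cancel-< j<l))

  extends-restrict : Extends M′ (restrict M′) i j
  extends-restrict = record
    { block  = λ a b → sym (entry-matrix (λ a b → entry M′ (inject₁ a) (inject₁ b)) a b)
    ; right⁺ = rightLeaf
    ; right⁻ = λ v → inject₁-injective (lastColumn _ v)
    ; below⁺ = belowLeaf
    ; below⁻ = λ v → inject₁-injective (lastRow _ v)
    ; corner = λ v → fromℕ≢inject₁ (lastRow _ v)
    }

  -- Removing the new row and column must turn `(i , j)` into a leaf without depriving another inner
  -- vertex of a vertex below or to the right. The delicate positions are those in row `i` and
  -- column `j`, which face the removed vertices.
  split⁻ : CNMWithLeaves (restrict M′) σ
  split⁻ = record { root = root′ root ; xor = xor⁻ E xor ; leaf = leaf′ ; inner = inner′ }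
    where
    E = extends-restrict
    M = restrict M′
    open Extends E

    root′ : (∃ λ x → ∃ λ y → IsRoot x y × Vertex M′ x y) → ∃ λ a → ∃ λ b → IsRoot a b × Vertex M a b
    root′ (x , y , r , v) with view x | view y
    ... | ‵fromℕ     | _          = contradiction (proj₁ r) toℕ-fromℕ≢0
    ... | ‵inject₁ a | ‵fromℕ     = contradiction (proj₂ r) toℕ-fromℕ≢0
    ... | ‵inject₁ a | ‵inject₁ b = a , b , root⁻ E {a} {b} r , vertex⁻ E v

    -- The leaf of row `i` in `M′` is in the new column, so every block vertex of that row is inner
    -- in `M′`; this explains the alternative `a ≡ i`.
    inner″ : ∀ {a b} → Vertex M a b → a ≡ i ⊎ lookup σ a ≢ b →
             HasBelow M′ (inject₁ a) (inject₁ b) × HasRight M′ (inject₁ a) (inject₁ b)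
    inner″ {a} v ≢b = inner _ _ (vertex⁺ E v) λ eq →
      let (a≢i , σa≡b) = splitPerm-inject₁⁻ i σ {a} eq in Sum.[ a≢i , (λ ≢ → ≢ σa≡b) ]′ ≢b

    -- If `j` is the last column, a vertex below `(i , j)` would be inner in `M′`, but the block has
    -- nothing to its right and the new column has its only vertex in row `i`.
    ¬below : ¬ HasBelow M i j
    ¬below (k , i<k , v) = Sum.[ (λ i-max → ℕ.<⇒≱ i<k (i-max k)) , rightmost ]′ extremal
      where
      k≢i : k ≢ i
      k≢i k≡i = Fin.<-irrefl (sym k≡i) i<k

      rightmost : ¬ ((l : Fin n) → l ≤ j)
      rightmost j-max with hasRight⁻ E (proj₂ (inner″ v (inj₂ λ σk≡j → k≢i (proj₁ σ-perm σk≡j))))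
      ... | inj₁ (l , j<l , _) = ℕ.<⇒≱ j<l (j-max l)
      ... | inj₂ k≡i           = k≢i k≡i

    -- The transposed argument: with `i` the last row, a vertex to the right would need one below
    -- it, and the only vertex of the new row is in column `j`.
    ¬right : ¬ HasRight M i j
    ¬right (l , j<l , v) = Sum.[ lowest , (λ j-max → ℕ.<⇒≱ j<l (j-max l)) ]′ extremal
      where
      lowest : ¬ ((k : Fin n) → k ≤ i)
      lowest i-max with hasBelow⁻ E (proj₁ (inner″ v (inj₁ refl)))
      ... | inj₁ (k , i<k , _) = ℕ.<⇒≱ i<k (i-max k)
      ... | inj₂ l≡j           = Fin.<-irrefl (sym l≡j) j<l

    leaf′ : ∀ a → Vertex M a (lookup σ a) × ¬ HasBelow M a (lookup σ a) × ¬ HasRight M a (lookup σ a)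
    leaf′ a with a ≟ᶠ i
    ... | yes refl = vertex⁻ E splitVertex , ¬below , ¬right
    ... | no a≢i   = let (v , ¬b , ¬r) = subst IsLeaf (splitPerm-other i σ a≢i) (leaf (inject₁ a)) in
      vertex⁻ E v , ¬b ∘ hasBelow⁺ E , ¬r ∘ hasRight⁺ E
      where
      IsLeaf : Fin (suc n) → Set
      IsLeaf y = Vertex M′ (inject₁ a) y × ¬ HasBelow M′ (inject₁ a) y × ¬ HasRight M′ (inject₁ a) y

    inner′ : ∀ a b → Vertex M a b → lookup σ a ≢ b → HasBelow M a b × HasRight M a b
    inner′ a b v σa≢b = let (below , right) = inner″ v (inj₂ σa≢b) in
      Sum.[ id , fromColumn ]′ (hasBelow⁻ E below) , Sum.[ id , fromRow ]′ (hasRight⁻ E right)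
      where
      fromColumn : b ≡ j → HasBelow M a b
      -- The vertex below may have been the removed one. If row `a` is above row `i`, the vertex
      -- `(i , j)` takes its place; the other two cases cannot occur.
      fromColumn refl with Fin.<-cmp a i
      ... | tri< a<i _ _ = i , a<i , vertex⁻ E splitVertex
      ... | tri≈ _ a≡i _ = contradiction (cong (lookup σ) a≡i) σa≢b
      ... | tri> _ _ i<a = contradiction (a , i<a , v) ¬below

      fromRow : a ≡ i → HasRight M a b
      fromRow refl with Fin.<-cmp b j
      ... | tri< b<j _ _ = j , b<j , vertex⁻ E splitVertex
      ... | tri≈ _ b≡j _ = contradiction (sym b≡j) σa≢b
      ... | tri> _ _ j<b = contradiction (b , j<b , v) ¬right

-- Splitting an extremal leaf preserves the number of matrices

bits-complete : (x : Bool) → x ∈ true ∷ false ∷ []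
bits-complete true  = here refl
bits-complete false = there (here refl)

allMatrices-complete : (M : Matrix n) → M ∈ allMatrices n
allMatrices-complete = allVec-complete (allVec-complete bits-complete)

allMatrices-unique : ∀ n → Unique (allMatrices n)
allMatrices-unique n = allVec-unique (allVec-unique (((λ ()) ∷ []) ∷ [] ∷ []) n) n

cnm? : (σ : Vec (Fin n) n) (M : Matrix n) → Dec (IsCNM M × leafMatrix M ≡ permutationMatrix σ)
cnm? σ M = isCNM? M ×-dec (leafMatrix M ≟ᴹ permutationMatrix σ)

-- Two injections give the two inequalities: `restrict`, where extremality enters and injectivity is
-- `extends-unique`, and `extend`, which is injective because `restrict` undoes it.
#CNM-splitPerm : (σ : Vec (Fin n) n) (i : Fin n) → IsPermutation σ → Extremal i σ →
                 #CNM (splitPerm i σ) ≡ #CNM σ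
#CNM-splitPerm {n} σ i σ-perm extremal = ℕ.≤-antisym
  (count-mono (cnm? σ′) (cnm? σ) (allMatrices-unique (suc n)) allMatrices-complete restrict
    (λ P → toCNM σ σ-perm (split⁻ σ i σ-perm extremal (spec′ P)))
    (λ {M′} {N′} P Q eq → extends-unique (extends-restrict σ i σ-perm extremal (spec′ P))
      (subst (λ M → Extends N′ M i (lookup σ i)) (sym eq)
        (extends-restrict σ i σ-perm extremal (spec′ Q)))))
  (count-mono (cnm? σ) (cnm? σ′) (allMatrices-unique n) allMatrices-complete
    (λ M → extend M i (lookup σ i))
    (λ {M} P → toCNM σ′ (splitPerm-isPermutation i σ σ-perm)
      (split⁺ σ i σ-perm (extend-extends M i (lookup σ i)) (fromCNM σ (proj₁ P) (proj₂ P))))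
    (λ {M} {N} _ _ eq → trans (sym (restrict-extends (extend-extends M i (lookup σ i))))
      (trans (cong restrict eq) (restrict-extends (extend-extends N i (lookup σ i))))))
  where
  σ′ = splitPerm i σ

  spec′ : ∀ {M′} → IsCNM M′ × leafMatrix M′ ≡ permutationMatrix σ′ → CNMWithLeaves M′ σ′
  spec′ (cnm , eq) = fromCNM σ′ cnm eq

-- The last corner and the two disjoint families of permutations

-- In size at least two the corner is not the root, so a vertex lies above it or to its left. Not
-- being a leaf, that vertex needs another one beyond the last column or beyond the last row,
-- respectively.
corner-not-leaf : ∀ {m} {M : Matrix (suc (suc m))} σ → IsPermutation σ → CNMWithLeaves M σ →
                  lookup σ (fromℕ (suc m)) ≢ fromℕ (suc m)
corner-not-leaf {m} {M} σ (inj , _) spec eq =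
  Sum.[ (λ (above , _) → fromAbove above) , (λ (_ , left) → fromLeft left) ]′
    (xor last last (subst (Vertex M last) eq (proj₁ (leaf last))) λ ())
  where
  open CNMWithLeaves spec
  last = fromℕ (suc m)

  fromAbove : ¬ HasAbove M last last
  fromAbove (k , k<last , v) =
    let (_ , (l , last<l , _)) = inner k last v λ σk≡ → Fin.<-irrefl (inj (trans σk≡ (sym eq))) k<last
    in ℕ.<⇒≱ last<l (fromℕ-max l)

  fromLeft : ¬ HasLeft M last last
  fromLeft (l , l<last , v) =
    let ((k , last<k , _) , _) = inner last l v λ σ≡l → Fin.<-irrefl (trans (sym σ≡l) eq) l<last
    in ℕ.<⇒≱ last<k (fromℕ-max k)

-- The value y itself is returned when σ does not attain y.

indexOf : Fin n → Vec (Fin n) n → Fin n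
indexOf y σ with any? (λ x → lookup σ x ≟ᶠ y)
... | yes (x , _) = x
... | no _        = y

lookup-indexOf : (y : Fin n) (σ : Vec (Fin n) n) → IsPermutation σ → lookup σ (indexOf y σ) ≡ y
lookup-indexOf y σ (_ , surj) with any? (λ x → lookup σ x ≟ᶠ y)
... | yes (_ , eq) = eq
... | no ¬∃       = contradiction (let (x , eq) = surj y in x , eq refl) ¬∃

realizable : (σ : Vec (Fin n) n) → #CNM σ ≥ 1 → ∃ λ M → CNMWithLeaves M σ
realizable {n} σ c =
  let (M , cnm , leaves) = count-witness (cnm? σ) (allMatrices n) c in M , fromCNM σ cnm leaves

HasCNMs : ℕ → Vec (Fin n) n → Set
HasCNMs k σ = IsPermutation σ × #CNM σ ≡ k

b-double : ∀ {k} (f g : Vec (Fin n) n → Vec (Fin (suc n)) (suc n)) →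
           (∀ {σ} → HasCNMs k σ → HasCNMs k (f σ)) → (∀ {σ} → HasCNMs k σ → HasCNMs k (g σ)) →
           (∀ {σ τ} → HasCNMs k σ → HasCNMs k τ → f σ ≡ f τ → σ ≡ τ) →
           (∀ {σ τ} → HasCNMs k σ → HasCNMs k τ → g σ ≡ g τ → σ ≡ τ) →
           (∀ {σ τ} → HasCNMs k σ → HasCNMs k τ → f σ ≢ g τ) →
           2 * b n k ℕ.≤ b (suc n) k
b-double {n} {k} = count-double (λ σ → isPermutation? σ ×-dec (#CNM σ ℕ.≟ k))
  (λ σ → isPermutation? σ ×-dec (#CNM σ ℕ.≟ k))
  (allVec-unique (Unique.allFin⁺ n) n) (allVec-complete ∈-allFin)

splitPerm-hasCNMs : ∀ {k} σ (i : Fin n) → Extremal i σ → HasCNMs k σ → HasCNMs k (splitPerm i σ)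
splitPerm-hasCNMs σ i extremal (perm , eq) =
  splitPerm-isPermutation i σ perm , trans (#CNM-splitPerm σ i perm extremal) eq

theorem5p1 : (n k : ℕ) → n ≥ 2 → k ≥ 1 → b (n + 1) k ≥ 2 * b n k
theorem5p1 n@(suc n′@(suc m)) k (s≤s (s≤s _)) k≥1 =
  subst (λ N → 2 * b n k ℕ.≤ b N k) (ℕ.+-comm 1 n)
    (b-double splitLastColumn splitLastRow
      (λ {σ} h → splitPerm-hasCNMs σ (indexOf last σ)
        (inj₂ λ l → subst (l ≤_) (sym (lookup-indexOf last σ (proj₁ h))) (fromℕ-max l)) h)
      (λ {σ} → splitPerm-hasCNMs σ last (inj₁ fromℕ-max))
      (λ _ _ → splitPerm-injective) (λ _ _ → splitPerm-injective)
      -- Disjointness: a common image forces `τ` to fix the last index, while `k ≥ 1` provides a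
      -- matrix with leaf permutation `τ`.
      λ {σ} {τ} (σ-perm , _) (τ-perm , #τ≡k) eq →
        let (M , spec) = realizable τ (subst (ℕ._≥ 1) (sym #τ≡k) k≥1)
        in corner-not-leaf τ τ-perm spec (fixesLast σ τ σ-perm eq))
  where
  last = fromℕ n′

  splitLastColumn splitLastRow : Vec (Fin n) n → Vec (Fin (suc n)) (suc n)
  splitLastColumn σ = splitPerm (indexOf last σ) σ
  splitLastRow = splitPerm last

  -- The last value of a split permutation is the value displaced by the split: here the largest old
  -- value on the `σ` side and `lookup τ last` on the other.
  fixesLast : ∀ σ τ → IsPermutation σ → splitLastColumn σ ≡ splitLastRow τ → lookup τ last ≡ last
  fixesLast σ τ perm eq = inject₁-injective (trans (sym (splitPerm-last last τ))
    (trans (cong (λ ρ → lookup ρ (fromℕ n)) (sym eq))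
      (trans (splitPerm-last (indexOf last σ) σ) (cong inject₁ (lookup-indexOf last σ perm)))))
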